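{- Every nonrecursive c.e. $D$-maximal set $A$ of Type 8 or 9 represents the least finite-one degree inside its many-one degree, i.e. $A\le_{\rm fo}B$ for every set $B\equiv_{\rm m}A$.
   Context: All sets are subsets of $\omega$; $X\subseteq^* Y$ means $X\setminus Y$ is finite. $A\le_{\rm m}B$: there is total computable $f$ with $x\in A\iff f(x)\in B$; $\equiv_{\rm m}$ is mutual $\le_{\rm m}$. $A\le_{\rm fo}B$: there is total computable $g$ with $x\in A\iff g(x)\in B$ and every fibre $g^{ -1}(\{y\})$ finite. A noncomputable c.e. set $A$ is $D$-maximal if for every c.e. $W\supseteq A$, either $W\setminus A$ is c.e. or there is a computable $R$ with $A\subseteq R\subseteq W$. For a c.e. set $A$, $\mathcal D(A)$ is the family of all c.e. sets disjoint from $A$; a finite or countable family $\{G_i:i\in I\}$ of c.e. sets disjoint from $A$ generates $\mathcal D(A)$ if every c.e. set $D$ disjoint from $A$ satisfies $D\subseteq^*\bigcup_{i\in F}G_i$ for some finite $F\subseteq I$. Generating family types: Type 1: $\{\varnothing\}$. Type 2: $\{R\}$, $R$ infinite computable. Type 3: $\{W\}$, $W$ infinite noncomputable c.e. Type 4: $\{R_0,R_1,\dots\}$, infinite pairwise disjoint computable. Type 5: $\{D_0,R_0,R_1,\dots\}$, $D_0$ noncomputable c.e., $R_i$ computable, all infinite and pairwise disjoint. Type 6: $\{D_0,D_1,\dots\}$, infinite pairwise disjoint noncomputable c.e. Type 7: $\{D_0,R_0,R_1,\dots\}$, $D_0$ noncomputable c.e., $R_i$ infinite pairwise disjoint computable,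 $D_0\cap R_i\ne\varnothing$ for infinitely many $i$. Type 8: $\{D_0,D_1,\dots,R_0,R_1,\dots\}$, the $D_i$ pairwise disjoint noncomputable c.e. sets and the $R_i$ infinite pairwise disjoint computable sets. Type 9: $\{D_0,D_1,\dots,R_0,R_1,\dots\}$, the $R_i$ infinite pairwise disjoint computable sets, the $D_i$ infinite nested ($D_0\subseteq D_1\subseteq\cdots$) noncomputable c.e. sets with $D_{\ell+1}\setminus D_\ell$ not c.e. for all $\ell$, and for every $\ell$ there are infinitely many $j$ with $R_j\setminus D_\ell$ infinite. A c.e. set $A$ is of Type $n$ if $\mathcal D(A)$ has a generating family of Type $n$ and none of Type $m$ for any $m<n$. -}

module Defs where

open import Level using (0ℓ)
open import Data.Nat using (ℕ; zero; suc; _≤_; _<_)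
open import Data.Fin using (Fin)
open import Data.Vec using (Vec; []; _∷_; lookup)
open import Data.Maybe using (Maybe; just; nothing)
open import Data.Maybe.Base using (_>>=_)
open import Data.Product using (Σ; ∃; ∃-syntax; _×_; _,_)
open import Data.Sum using (_⊎_)
open import Data.Unit using (⊤)
open import Data.Empty using (⊥)
import Data.Empty.Polymorphic
import Data.Sum
open import Data.List using (List)
open import Data.List.Membership.Propositional using (_∈_)
open import Relation.Nullary using (¬_)
open import Relation.Binary.PropositionalEquality using (_≡_; _≢_)
open import Function.Bundles using (_⇔_)

data Code : ℕ → Set where
  zer  : ∀ {n} → Code n
  succ : Code 1
  proj : ∀ {n} → Fin n → Code n
  comp : ∀ {m n} → Code m → Vec (Code n) m → Code n
  prec : ∀ {n} → Code n → Code (suc (suc n)) → Code (suc n)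
  mu   : ∀ {n} → Code (suc n) → Code n

mutual
  eval : ℕ → ∀ {n} → Code n → Vec ℕ n → Maybe ℕ
  eval zero    _          _             = nothing
  eval (suc k) zer        _             = just 0
  eval (suc k) succ       (x ∷ [])      = just (suc x)
  eval (suc k) (proj i)   xs            = just (lookup xs i)
  eval (suc k) (comp f gs) xs           = evalVec k gs xs >>= λ ys → eval k f ys
  eval (suc k) (prec f g) (zero ∷ xs)   = eval k f xs
  eval (suc k) (prec f g) (suc y ∷ xs)  =
    eval k (prec f g) (y ∷ xs) >>= λ r → eval k g (y ∷ r ∷ xs)
  eval (suc k) (mu f)     xs            = search k f 0 xs

  evalVec : ℕ → ∀ {m n} → Vec (Code n) m → Vec ℕ n → Maybe (Vec ℕ m)
  evalVec k []       xs = just []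
  evalVec k (g ∷ gs) xs =
    eval k g xs >>= λ y → evalVec k gs xs >>= λ ys → just (y ∷ ys)

  search : ℕ → ∀ {n} → Code (suc n) → ℕ → Vec ℕ n → Maybe ℕ
  search zero    f y xs = nothing
  search (suc k) f y xs with eval k f (y ∷ xs)
  ... | nothing      = nothing
  ... | just zero    = just y
  ... | just (suc _) = search k f (suc y) xs

_⟨_⟩↓_ : ∀ {n} → Code n → Vec ℕ n → ℕ → Set
c ⟨ xs ⟩↓ y = ∃[ k ] (eval k c xs ≡ just y)

SetN : Set₁
SetN = ℕ → Set

Empty : SetN
Empty _ = ⊥

_⊆_ : SetN → SetN → Set
X ⊆ Y = ∀ x → X x → Y x

_∖_ : SetN → SetN → SetN
(X ∖ Y) x = X x × ¬ Y x

Disjoint : SetN → SetN → Set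
Disjoint X Y = ∀ x → X x → Y x → ⊥

Finite : SetN → Set
Finite X = ∃[ n ] (∀ x → X x → x < n)

Infinite : SetN → Set
Infinite X = ¬ Finite X

_⊆*_ : SetN → SetN → Set
X ⊆* Y = Finite (X ∖ Y)

CE : SetN → Set
CE A = ∃[ c ] (∀ x → A x ⇔ (∃[ y ] (c ⟨ x ∷ [] ⟩↓ y)))

Computable : SetN → Set
Computable A = ∃[ c ] (∀ x → (A x → c ⟨ x ∷ [] ⟩↓ 1) × (¬ A x → c ⟨ x ∷ [] ⟩↓ 0))

TotalComputableFn : (ℕ → ℕ) → Set
TotalComputableFn f = ∃[ c ] (∀ x → c ⟨ x ∷ [] ⟩↓ f x)

_≤m_ : SetN → SetN → Set
A ≤m B = ∃[ f ] (TotalComputableFn f × (∀ x → A x ⇔ B (f x)))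

_≡m_ : SetN → SetN → Set
A ≡m B = (A ≤m B) × (B ≤m A)

FiniteFibres : (ℕ → ℕ) → Set
FiniteFibres g = ∀ y → Finite (λ x → g x ≡ y)

_≤fo_ : SetN → SetN → Set
A ≤fo B = ∃[ g ] (TotalComputableFn g × FiniteFibres g × (∀ x → A x ⇔ B (g x)))

DMaximal : SetN → Set₁
DMaximal A = CE A × ¬ Computable A ×
  (∀ W → CE W → A ⊆ W →
     CE (W ∖ A) ⊎ (∃[ R ] (Computable R × A ⊆ R × R ⊆ W)))

UnionOver : {I : Set} → (I → SetN) → List I → SetN
UnionOver G F x = ∃[ i ] (i ∈ F × G i x)

Generates : SetN → (I : Set) → (I → SetN) → Set₁
Generates A I G =
  (∀ i → CE (G i)) × (∀ i → Disjoint (G i) A) ×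
  (∀ D → CE D → Disjoint D A → ∃[ F ] (D ⊆* UnionOver G F))

PairwiseDisjoint : (ℕ → SetN) → Set
PairwiseDisjoint X = ∀ i j → i ≢ j → Disjoint (X i) (X j)

InfinitelyMany : (ℕ → Set) → Set
InfinitelyMany P = Infinite P

Noncomputable : SetN → Set
Noncomputable X = ¬ Computable X

pairFam : SetN → (ℕ → SetN) → (⊤ ⊎ ℕ → SetN)
pairFam D R (Data.Sum.inj₁ _) = D
pairFam D R (Data.Sum.inj₂ i) = R i

twoFam : (ℕ → SetN) → (ℕ → SetN) → (ℕ ⊎ ℕ → SetN)
twoFam D R (Data.Sum.inj₁ i) = D i
twoFam D R (Data.Sum.inj₂ i) = R i

HasGenType : ℕ → SetN → Set₁
HasGenType 1 A = Generates A ⊤ (λ _ → Empty)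
HasGenType 2 A = ∃[ R ] (Infinite R × Computable R × Generates A ⊤ (λ _ → R))
HasGenType 3 A = ∃[ W ] (Infinite W × CE W × Noncomputable W × Generates A ⊤ (λ _ → W))
HasGenType 4 A = ∃[ R ] ((∀ i → Infinite (R i) × Computable (R i)) ×
  PairwiseDisjoint R × Generates A ℕ R)
HasGenType 5 A = ∃[ D ] ∃[ R ] (CE D × Noncomputable D × (∀ i → Computable (R i)) ×
  (∀ j → Infinite (pairFam D R j)) ×
  (∀ j k → j ≢ k → Disjoint (pairFam D R j) (pairFam D R k)) ×
  Generates A (⊤ ⊎ ℕ) (pairFam D R))
HasGenType 6 A = ∃[ D ] ((∀ i → Infinite (D i) × CE (D i) × Noncomputable (D i)) ×
  PairwiseDisjoint D × Generates A ℕ D)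
HasGenType 7 A = ∃[ D ] ∃[ R ] (CE D × Noncomputable D ×
  (∀ i → Infinite (R i) × Computable (R i)) × PairwiseDisjoint R ×
  InfinitelyMany (λ i → ∃[ x ] (D x × R i x)) ×
  Generates A (⊤ ⊎ ℕ) (pairFam D R))
HasGenType 8 A = ∃[ D ] ∃[ R ] ((∀ i → CE (D i) × Noncomputable (D i)) × PairwiseDisjoint D ×
  (∀ i → Infinite (R i) × Computable (R i)) × PairwiseDisjoint R ×
  Generates A (ℕ ⊎ ℕ) (twoFam D R))
HasGenType 9 A = ∃[ D ] ∃[ R ] ((∀ i → Infinite (R i) × Computable (R i)) × PairwiseDisjoint R ×
  (∀ ℓ → Infinite (D ℓ) × CE (D ℓ) × Noncomputable (D ℓ)) ×
  (∀ ℓ → D ℓ ⊆ D (suc ℓ)) ×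
  (∀ ℓ → ¬ CE (D (suc ℓ) ∖ D ℓ)) ×
  (∀ ℓ → InfinitelyMany (λ j → Infinite (R j ∖ D ℓ))) ×
  Generates A (ℕ ⊎ ℕ) (twoFam D R))
HasGenType _ A = Data.Empty.Polymorphic.⊥

OfType : ℕ → SetN → Set₁
OfType n A = HasGenType n A × (∀ m → m < n → ¬ HasGenType m A)

{-# OPTIONS --safe #-}
module Submission where

-- Let f reduce A to B and let s x be the least z with f z = f x, so that f is
-- injective on the computable set S = {x : s x = x}. Apply D-maximality to
-- A ∪ S. If S ∖ A were c.e., so would be the complement of A (x ∉ A iff
-- s x ∈ S ∖ A), making A computable. Hence A ⊆ R ⊆ A ∪ S with R computable.
-- Keep f on R ∩ S; on R ∖ S ⊆ A use values g x ≥ x in f(A), an unbounded subset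
-- of B because A is not computable; off R use values g x ≥ x in f(D), for some
-- c.e. D disjoint from A with f(D) unbounded. Such a D exists, for otherwise the
-- infinite fibres of f outside A would be a generating family of Type 1, 2 or 4
-- (after merging them into one set when there are only finitely many).

open import Defs
open import Level using (0ℓ)
open import Data.Sum as Sum using (_⊎_; inj₁; inj₂; [_,_]′)
open import Relation.Binary.Definitions using (tri<; tri≈; tri>)
open import Relation.Nullary using (¬_; yes; no; contradiction)
open import Axiom.ExcludedMiddle using (ExcludedMiddle)
open import Axiom.DoubleNegationElimination using (em⇒dne)
open import Data.Empty using (⊥-elim)
open import Data.Fin using (Fin; zero; suc)
open import Data.List using (upTo; [_])
open import Data.List.Membership.Propositional.Properties using (∈-upTo⁺)
open import Data.List.Relation.Unary.Any using (here)
open import Data.Maybe using (Maybe; just; nothing)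
open import Data.Maybe.Base using (_>>=_)
open import Data.Maybe.Properties using (just-injective)
open import Data.Nat
  using (ℕ; zero; suc; pred; _+_; _∸_; _⊔_; _≤_; _<_; z≤n; s≤s; s≤s⁻¹)
open import Data.Nat.Properties
open import Data.Product using (∃-syntax; _×_; _,_; proj₁; proj₂)
open import Data.Unit using (tt)
open import Data.Vec using (Vec; []; _∷_; lookup; head; tail; tabulate)
open import Data.Vec.Properties using (tabulate∘lookup)
open import Function using (_∘_; id)
open import Function.Bundles using (_⇔_; mk⇔; module Equivalence)
open import Relation.Binary.PropositionalEquality
  using (_≡_; _≢_; refl; sym; trans; cong; subst; _≗_)

open Equivalence using (to; from)

private variable
  k l m n : ℕ

-- Fuel

_⊑_ : {X : Set} → Maybe X → Maybe X → Set
p ⊑ q = ∀ {y} → p ≡ just y → q ≡ just y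

>>=-mono : {X Y : Set} {p q : Maybe X} {f g : X → Maybe Y} →
  p ⊑ q → (∀ x → f x ⊑ g x) → (p >>= f) ⊑ (q >>= g)
>>=-mono {p = just x} p⊑q f⊑g e rewrite p⊑q refl = f⊑g x e

>>=-just : {X Y : Set} {p : Maybe X} {f : X → Maybe Y} {x : X} {y : Y} →
  p ≡ just x → f x ≡ just y → (p >>= f) ≡ just y
>>=-just refl e = e

mutual
  -- Extra fuel never changes a value already returned, so subcomputations that converge with
  -- different fuels can be rerun together at the maximum of these.
  eval-mono : k ≤ l → (c : Code n) (xs : Vec ℕ n) → eval k c xs ⊑ eval l c xs
  eval-mono (s≤s p) zer         xs           = id
  eval-mono (s≤s p) succ        (x ∷ [])     = id
  eval-mono (s≤s p) (proj i)    xs           = id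
  eval-mono (s≤s p) (comp f gs) xs           =
    >>=-mono (evalVec-mono p gs xs) (eval-mono p f)
  eval-mono (s≤s p) (prec f g)  (zero ∷ xs)  = eval-mono p f xs
  eval-mono (s≤s p) (prec f g)  (suc y ∷ xs) =
    >>=-mono (eval-mono p (prec f g) (y ∷ xs)) (λ r → eval-mono p g (y ∷ r ∷ xs))
  eval-mono (s≤s p) (mu f)      xs           = search-mono p f 0 xs

  evalVec-mono : k ≤ l → (gs : Vec (Code n) m) (xs : Vec ℕ n) → evalVec k gs xs ⊑ evalVec l gs xs
  evalVec-mono p []       xs = id
  evalVec-mono p (g ∷ gs) xs =
    >>=-mono (eval-mono p g xs) (λ y → >>=-mono (evalVec-mono p gs xs) (λ ys → id))

  search-mono : k ≤ l → (f : Code (suc n)) (y : ℕ) (xs : Vec ℕ n) → search k f y xs ⊑ search l f y xs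
  search-mono (s≤s {k} {l} p) f y xs with eval k f (y ∷ xs) | eval-mono p f (y ∷ xs)
  ... | just zero    | f⊑ rewrite f⊑ refl = id
  ... | just (suc _) | f⊑ rewrite f⊑ refl = search-mono p f (suc y) xs

↓-functional : (c : Code n) {xs : Vec ℕ n} {y z : ℕ} → c ⟨ xs ⟩↓ y → c ⟨ xs ⟩↓ z → y ≡ z
↓-functional c {xs} (k , p) (l , q) = just-injective
  (trans (sym (eval-mono (m≤m⊔n k l) c xs p)) (eval-mono (m≤n⊔m k l) c xs q))

-- Total recursive functions

Recursive : (Vec ℕ n → ℕ) → Set
Recursive {n} F = ∃[ c ] (∀ (xs : Vec ℕ n) → c ⟨ xs ⟩↓ F xs)

-- Recursiveness is asked of each component, so no coding of vectors by numbers is needed. Being a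
-- record, it lets `V` be recovered by unification.
record RecursiveVec (V : Vec ℕ n → Vec ℕ m) : Set where
  constructor components
  field component : ∀ i → Recursive (λ xs → lookup (V xs) i)

open RecursiveVec

private variable
  F G H : Vec ℕ n → ℕ
  V     : Vec ℕ n → Vec ℕ m

recursive-resp : F ≗ G → Recursive F → Recursive G
recursive-resp F≗G (c , p) = c , λ xs → subst (c ⟨ xs ⟩↓_) (F≗G xs) (p xs)

var : (i : Fin n) → Recursive (λ xs → lookup xs i)
var i = proj i , λ xs → 1 , refl

recursive-head : Recursive {suc n} head
recursive-head = recursive-resp (λ { (x ∷ xs) → refl }) (var zero)

vars : RecursiveVec {n} id
vars = components var

tailᵛ : RecursiveVec V → RecursiveVec (tail ∘ V)
tailᵛ {V = V} r = components λ i → recursive-resp (λ xs → lookup-suc (V xs)) (component r (suc i))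
  where
  lookup-suc : (ys : Vec ℕ (suc m)) {i : Fin m} → lookup ys (suc i) ≡ lookup (tail ys) i
  lookup-suc (y ∷ ys) = refl

infixr 5 _∷ᵛ_
_∷ᵛ_ : Recursive F → RecursiveVec V → RecursiveVec (λ xs → F xs ∷ V xs)
r ∷ᵛ rs = components λ { zero → r ; (suc i) → component rs i }

[]ᵛ : RecursiveVec {n} (λ _ → [])
[]ᵛ = components λ ()

evalVec-tabulate : (gs : Fin m → Code n) {xs : Vec ℕ n} {y : Fin m → ℕ} →
  (∀ i → gs i ⟨ xs ⟩↓ y i) → ∃[ k ] (evalVec k (tabulate gs) xs ≡ just (tabulate y))
evalVec-tabulate {zero}  gs p = 0 , refl
evalVec-tabulate {suc m} gs {xs} p
  with k , e ← p zero | l , e′ ← evalVec-tabulate (gs ∘ suc) (p ∘ suc)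
  = k ⊔ l , lemma
  where
  lemma : evalVec (k ⊔ l) (tabulate gs) xs ≡ _
  lemma rewrite eval-mono (m≤m⊔n k l) (gs zero) xs e
              | evalVec-mono (m≤n⊔m k l) (tabulate (gs ∘ suc)) xs e′ = refl

_∘ᵛ_ : Recursive F → RecursiveVec V → Recursive (F ∘ V)
_∘ᵛ_ {F = F} {V = V} (c , p) r = comp c (tabulate gs) , conv
  where
  gs = proj₁ ∘ component r
  conv : ∀ xs → comp c (tabulate gs) ⟨ xs ⟩↓ F (V xs)
  conv xs with k , e ← evalVec-tabulate gs (λ i → proj₂ (component r i) xs) | l , e′ ← p (V xs)
    rewrite tabulate∘lookup (V xs) =
      suc (k ⊔ l) ,
      >>=-just {f = eval (k ⊔ l) c}
        (evalVec-mono (m≤m⊔n k l) (tabulate gs) xs e) (eval-mono (m≤n⊔m k l) c (V xs) e′)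

weaken : Recursive F → Recursive {suc n} (F ∘ tail)
weaken r = r ∘ᵛ tailᵛ vars

recℕ : ℕ → ℕ → (ℕ → ℕ → ℕ) → ℕ
recℕ zero    z s = z
recℕ (suc n) z s = s n (recℕ n z s)

-- Binders follow the argument order of `prec`: inside `H`, variable 0 is the counter, variable 1
-- the recursive value, and the ambient arguments come after. The indices in later uses count
-- through nested binders in this way.
recursive-rec : Recursive F → Recursive G → Recursive H →
  Recursive (λ xs → recℕ (F xs) (G xs) (λ y r → H (y ∷ r ∷ xs)))
recursive-rec {G = G} {H = H} rF (g , p) (h , q) =
  recursive ∘ᵛ (rF ∷ᵛ vars)
  where
  value : Vec ℕ (suc _) → ℕ
  value ys = recℕ (head ys) (G (tail ys)) (λ y r → H (y ∷ r ∷ tail ys))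
  conv : ∀ y xs → prec g h ⟨ y ∷ xs ⟩↓ value (y ∷ xs)
  conv zero    xs with k , e ← p xs = suc k , e
  conv (suc y) xs with k , e ← conv y xs | l , e′ ← q (y ∷ value (y ∷ xs) ∷ xs) =
    suc (k ⊔ l) ,
      >>=-just (eval-mono (m≤m⊔n k l) (prec g h) (y ∷ xs) e) (eval-mono (m≤n⊔m k l) h (y ∷ _ ∷ xs) e′)
  recursive : Recursive value
  recursive = prec g h , λ { (y ∷ xs) → conv y xs }

caseℕ : ℕ → ℕ → (ℕ → ℕ) → ℕ
caseℕ zero    z s = z
caseℕ (suc n) z s = s n

-- Case distinction is primitive recursion that ignores the recursive value; the double `tailᵛ`
-- drops it.
recursive-case : Recursive F → Recursive G → Recursive H →
  Recursive (λ xs → caseℕ (F xs) (G xs) (λ y → H (y ∷ xs)))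
recursive-case {F = F} {G = G} {H = H} rF rG rH =
  recursive-resp (λ xs → rec≡case (F xs)) (recursive-rec rF rG (rH ∘ᵛ (var zero ∷ᵛ tailᵛ (tailᵛ vars))))
  where
  rec≡case : ∀ y {z} {s : ℕ → ℕ} → recℕ y z (λ n _ → s n) ≡ caseℕ y z s
  rec≡case zero    = refl
  rec≡case (suc y) = refl

recursive-suc : Recursive F → Recursive (suc ∘ F)
recursive-suc r = recursive ∘ᵛ (r ∷ᵛ []ᵛ)
  where
  recursive : Recursive (suc ∘ head)
  recursive = succ , λ { (x ∷ []) → 1 , refl }

recursive-const : ∀ a → Recursive {n} (λ _ → a)
recursive-const zero    = zer , λ _ → 1 , refl
recursive-const (suc a) = recursive-suc (recursive-const a)

recursive-pred : Recursive F → Recursive (pred ∘ F)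
recursive-pred {F = F} r =
  recursive-resp (λ xs → case≡pred (F xs)) (recursive-case r (recursive-const 0) (var zero))
  where
  case≡pred : ∀ y → caseℕ y 0 id ≡ pred y
  case≡pred zero    = refl
  case≡pred (suc y) = refl

recursive-+ : Recursive F → Recursive G → Recursive (λ xs → F xs + G xs)
recursive-+ {F = F} rF rG =
  recursive-resp (λ xs → rec≡+ (F xs)) (recursive-rec rF rG (recursive-suc (var (suc zero))))
  where
  rec≡+ : ∀ y {z} → recℕ y z (λ _ → suc) ≡ y + z
  rec≡+ zero    = refl
  rec≡+ (suc y) = cong suc (rec≡+ y)

recursive-∸ : Recursive F → Recursive G → Recursive (λ xs → F xs ∸ G xs)
recursive-∸ {F = F} {G = G} rF rG =
  recursive-resp (λ xs → rec≡∸ (F xs) (G xs)) (recursive-rec rG rF (recursive-pred (var (suc zero))))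
  where
  rec≡∸ : ∀ z y → recℕ y z (λ _ → pred) ≡ z ∸ y
  rec≡∸ z zero    = refl
  rec≡∸ z (suc y) = trans (cong pred (rec≡∸ z y)) (pred[m∸n]≡m∸[1+n] z y)

apply : {f : ℕ → ℕ} → TotalComputableFn f → Recursive F → Recursive (f ∘ F)
apply {f = f} (c , p) r = recursive ∘ᵛ (r ∷ᵛ []ᵛ)
  where
  recursive : Recursive (f ∘ head)
  recursive = c , λ { (x ∷ []) → p x }

toTotal : {F : Vec ℕ 1 → ℕ} → Recursive F → TotalComputableFn (λ x → F (x ∷ []))
toTotal (c , p) = c , λ x → p (x ∷ [])

-- Zero stands for truth throughout, so this is negation. Applied to an encoded clocked evaluation,
-- it turns convergence into a zero.
isZero : ℕ → ℕ
isZero y = caseℕ y 1 (λ _ → 0)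

recursive-isZero : Recursive F → Recursive (isZero ∘ F)
recursive-isZero r = recursive-case r (recursive-const 1) (recursive-const 0)

distance : ℕ → ℕ → ℕ
distance x y = (x ∸ y) + (y ∸ x)

distance≡0 : ∀ {x y} → distance x y ≡ 0 → x ≡ y
distance≡0 {x} {y} e = ≤-antisym (m∸n≡0⇒m≤n (m+n≡0⇒m≡0 _ e)) (m∸n≡0⇒m≤n (m+n≡0⇒n≡0 (x ∸ y) e))

distance-refl : ∀ {x y} → x ≡ y → distance x y ≡ 0
distance-refl {x} refl rewrite n∸n≡0 x = refl

recursive-distance : Recursive F → Recursive G → Recursive (λ xs → distance (F xs) (G xs))
recursive-distance rF rG = recursive-+ (recursive-∸ rF rG) (recursive-∸ rG rF)

-- Minimisation

-- The known zero `b` bounds the search: either `h` vanishes at 0, or `h` is shifted by one and the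
-- bound drops.
least : (h : ℕ → ℕ) {b : ℕ} → h b ≡ 0 → ∃[ y ] (h y ≡ 0 × (∀ z → h z ≡ 0 → y ≤ z))
least h {zero}  e = 0 , e , λ _ _ → z≤n
least h {suc b} e with h 0 in eq
... | zero  = 0 , eq , λ _ _ → z≤n
... | suc _ with y , e′ , y≤ ← least (h ∘ suc) e =
  suc y , e′ , λ { zero h0 → contradiction (trans (sym eq) h0) λ () ; (suc z) hz → s≤s (y≤ z hz) }

-- Induction on `d`, the number of candidates still to be rejected before the least zero `d + y`.
search-finds : (c : Code (suc n)) (h : ℕ → ℕ) {xs : Vec ℕ n} → (∀ y → c ⟨ y ∷ xs ⟩↓ h y) →
  ∀ d y → h (d + y) ≡ 0 → (∀ z → h z ≡ 0 → d + y ≤ z) → ∃[ k ] (search k c y xs ≡ just (d + y))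
search-finds c h {xs} conv zero y hy _ with k , e ← conv y = suc k , found
  where
  found : search (suc k) c y xs ≡ just y
  found rewrite e | hy = refl
search-finds c h {xs} conv (suc d) y hy below
  with k , e ← conv y
     | l , e′ ← search-finds c h conv d (suc y) (trans (cong h (+-suc d y)) hy)
                  (λ z hz → subst (_≤ z) (sym (+-suc d y)) (below z hz))
  = suc (k ⊔ l) , skipped
  where
  skipped : search (suc (k ⊔ l)) c y xs ≡ just (suc (d + y))
  skipped rewrite eval-mono (m≤m⊔n k l) c (y ∷ xs) e with h y in hy′
  -- A zero at `y` itself would contradict minimality, which puts every zero at or above
  -- `suc (d + y)`.
  ... | zero  = contradiction (below y hy′) (<⇒≱ (s≤s (m≤n+m y d)))
  ... | suc _ = trans (search-mono (m≤n⊔m k l) c (suc y) xs e′) (cong just (+-suc d y))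

search-zero : ∀ k (c : Code (suc n)) y {xs : Vec ℕ n} {z} → search k c y xs ≡ just z → c ⟨ z ∷ xs ⟩↓ 0
search-zero (suc k) c y {xs} e with eval k c (y ∷ xs) in eq
search-zero (suc k) c y refl | just zero    = k , eq
search-zero (suc k) c y e    | just (suc _) = search-zero k c (suc y) e

mu-least : (c : Code (suc n)) (h : ℕ → ℕ) {xs : Vec ℕ n} → (∀ y → c ⟨ y ∷ xs ⟩↓ h y) →
  ∀ {y} → h y ≡ 0 → (∀ z → h z ≡ 0 → y ≤ z) → mu c ⟨ xs ⟩↓ y
mu-least c h {xs} conv {y} hy below
  with k , e ← search-finds c h conv y 0 (trans (cong h (+-identityʳ y)) hy)
                 (λ z hz → subst (_≤ z) (sym (+-identityʳ y)) (below z hz))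
  = suc k , trans e (cong just (+-identityʳ y))

minimise : {F : Vec ℕ (suc n) → ℕ} → Recursive F → (∀ xs → ∃[ y ] (F (y ∷ xs) ≡ 0)) →
  ∃[ M ] (Recursive M × (∀ xs → F (M xs ∷ xs) ≡ 0) × (∀ xs y → F (y ∷ xs) ≡ 0 → M xs ≤ y))
minimise {F = F} (c , p) total =
  (λ xs → proj₁ (min xs)) ,
  (mu c , λ xs → mu-least c (λ y → F (y ∷ xs)) (λ y → p (y ∷ xs)) (proj₁ (proj₂ (min xs))) (proj₂ (proj₂ (min xs)))) ,
  (λ xs → proj₁ (proj₂ (min xs))) ,
  (λ xs → proj₂ (proj₂ (min xs)))
  where
  min : ∀ xs → ∃[ y ] (F (y ∷ xs) ≡ 0 × (∀ z → F (z ∷ xs) ≡ 0 → y ≤ z))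
  min xs = least (λ y → F (y ∷ xs)) (proj₂ (total xs))

-- Clocked evaluation is recursive

encode : Maybe ℕ → ℕ
encode nothing  = 0
encode (just y) = suc y

-- This plays the role of Kleene's normal form: fuel becomes a numerical argument, so stages of a
-- computation can be inspected by total recursive functions.
clocked : Code n → Vec ℕ (suc n) → ℕ
clocked c ys = encode (eval (head ys) c (tail ys))

clocked-by-suc : (c : Code n) → Recursive {suc n} (λ ys → encode (eval (suc (head ys)) c (tail ys))) →
  Recursive (clocked c)
clocked-by-suc c r =
  recursive-resp (λ { (zero ∷ xs) → refl ; (suc k ∷ xs) → refl })
    (recursive-case (var zero) (recursive-const 0) (r ∘ᵛ (var zero ∷ᵛ tailᵛ (tailᵛ vars))))

-- A possibly undefined vector is represented by a vector and a numerical flag. When the flag is 0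
-- the vector is an arbitrary default.
data Flagged {X : Set} (x : X) : Maybe X → ℕ → Set where
  undefined : Flagged x nothing 0
  defined   : ∀ {a} → Flagged x (just x) (suc a)

-- `search` spends one unit of fuel per candidate. Recursion on the remaining fuel therefore builds
-- it from the exhausted end, the recursive value being the result of continuing with the next
-- candidate.
clocked-mu : (f : Code (suc n)) → Recursive (clocked f) → Recursive (clocked (mu f))
clocked-mu f r = clocked-by-suc (mu f)
  (recursive-resp (λ { (b ∷ xs) → trans (loop-search b xs b ≤-refl) (cong (λ y → encode (search b f y xs)) (n∸n≡0 b)) })
    (recursive-rec (var zero) (recursive-const 0)
      (recursive-case (r ∘ᵛ (var zero ∷ᵛ pos ∷ᵛ tailᵛ (tailᵛ (tailᵛ vars))))
        (recursive-const 0)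
        (recursive-case (var zero) (recursive-suc (weaken pos)) (var (suc (suc (suc zero))))))))
  where
  pos : Recursive {suc (suc (suc n))} (λ ys → head (tail (tail ys)) ∸ suc (head ys))
  pos = recursive-resp (λ { (_ ∷ _ ∷ _ ∷ _) → refl })
    (recursive-∸ (var (suc (suc zero))) (recursive-suc (var zero)))
  -- With q units of fuel left out of b, the search has reached the candidate b ∸ q.
  loop-search : ∀ b xs q → q ≤ b →
    recℕ q 0 (λ q r → caseℕ (clocked f (q ∷ (b ∸ suc q) ∷ xs)) 0
      (λ v → caseℕ v (suc (b ∸ suc q)) (λ _ → r))) ≡ encode (search q f (b ∸ q) xs)
  loop-search b xs zero    _   = refl
  loop-search b xs (suc q) q<b with eval q f ((b ∸ suc q) ∷ xs)
  ... | nothing      = refl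
  ... | just zero    = refl
  ... | just (suc _) = trans (loop-search b xs q (<⇒≤ q<b))
    (cong (λ y → encode (search q f y xs)) (+-∸-assoc 1 q<b))

-- Descending to the base case costs `y` units of fuel, so nothing is returned unless `y < k`.
-- Otherwise `k ∸ y` is some `suc a`, and `f` runs with fuel `a`.
clocked-prec : (f : Code n) (g : Code (suc (suc n))) →
  Recursive (clocked f) → Recursive (clocked g) → Recursive (clocked (prec f g))
clocked-prec f g rf rg =
  recursive-resp (λ { (k ∷ y ∷ xs) → correct k y xs })
    (recursive-case (recursive-∸ (var zero) (var (suc zero))) (recursive-const 0)
      (recursive-rec (var (suc (suc zero)))
        (rf ∘ᵛ (var zero ∷ᵛ tailᵛ (tailᵛ (tailᵛ vars))))
        (recursive-case (var (suc zero)) (recursive-const 0)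
          (rg ∘ᵛ (recursive-suc (recursive-+ (var (suc zero)) (var (suc (suc (suc zero)))))
            ∷ᵛ var (suc zero) ∷ᵛ var zero
            ∷ᵛ tailᵛ (tailᵛ (tailᵛ (tailᵛ (tailᵛ (tailᵛ vars))))))))))
  where
  -- The recursion is unwound one unit of fuel per level, so level j runs with fuel suc (j + a).
  loop : ℕ → Vec ℕ _ → ℕ → ℕ
  loop a xs y = recℕ y (clocked f (a ∷ xs)) (λ j r → caseℕ r 0 (λ v → clocked g (suc (j + a) ∷ j ∷ v ∷ xs)))
  loop-eval : ∀ a xs y → loop a xs y ≡ encode (eval (suc (y + a)) (prec f g) (y ∷ xs))
  loop-eval a xs zero    = refl
  loop-eval a xs (suc y) rewrite loop-eval a xs y with eval (suc (y + a)) (prec f g) (y ∷ xs)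
  ... | nothing = refl
  ... | just v  = refl
  starved : ∀ k y xs → k ≤ y → eval k (prec f g) (y ∷ xs) ≡ nothing
  starved zero    y       xs _       = refl
  starved (suc k) (suc y) xs (s≤s p) rewrite starved k y xs p = refl
  correct : ∀ k y xs → caseℕ (k ∸ y) 0 (λ a → loop a xs y) ≡ clocked (prec f g) (k ∷ y ∷ xs)
  correct k y xs with k ∸ y in eq
  ... | zero  = cong encode (sym (starved k y xs (m∸n≡0⇒m≤n eq)))
  ... | suc a = trans (loop-eval a xs y) (cong (λ k → encode (eval k (prec f g) (y ∷ xs))) fuel)
    where
    fuel : suc (y + a) ≡ k
    fuel = trans (sym (+-suc y a)) (trans (cong (y +_) (sym eq))
      (m+[n∸m]≡n (<⇒≤ (m∸n≢0⇒n<m {k} {y} λ z → contradiction (trans (sym eq) z) λ ()))))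

mutual
  clocked-recursive : (c : Code n) → Recursive (clocked c)
  clocked-recursive zer         = clocked-by-suc zer (recursive-const 1)
  clocked-recursive succ        = clocked-by-suc succ
    (recursive-resp (λ { (k ∷ x ∷ []) → refl }) (recursive-suc (recursive-suc (var (suc zero)))))
  clocked-recursive (proj i)    = clocked-by-suc (proj i)
    (recursive-resp (λ { (k ∷ xs) → refl }) (recursive-suc (var (suc i))))
  clocked-recursive (prec f g)  = clocked-prec f g (clocked-recursive f) (clocked-recursive g)
  clocked-recursive (mu f)      = clocked-mu f (clocked-recursive f)
  clocked-recursive (comp f gs) with V , φ , rV , rφ , flag ← clockedVec-recursive gs =
    clocked-by-suc (comp f gs)
      (recursive-resp (λ ys → bind ys (flag ys))
        (recursive-case rφ (recursive-const 0)
          (weaken (clocked-recursive f ∘ᵛ (recursive-head ∷ᵛ rV)))))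
    where
    bind : ∀ ys {v w a} → Flagged v w a →
      caseℕ a 0 (λ _ → clocked f (head ys ∷ v)) ≡ encode (w >>= eval (head ys) f)
    bind ys undefined = refl
    bind ys defined   = refl

  clockedVec-recursive : (gs : Vec (Code n) m) → ∃[ V ] ∃[ φ ] (RecursiveVec V × Recursive φ ×
    (∀ ys → Flagged (V ys) (evalVec (head ys) gs (tail ys)) (φ ys)))
  clockedVec-recursive []       = (λ _ → []) , (λ _ → 1) , []ᵛ , recursive-const 1 , λ ys → defined
  clockedVec-recursive (g ∷ gs) with V , φ , rV , rφ , flag ← clockedVec-recursive gs =
    (λ ys → pred (clocked g ys) ∷ V ys) ,
    (λ ys → caseℕ (clocked g ys) 0 (λ _ → φ ys)) ,
    recursive-pred (clocked-recursive g) ∷ᵛ rV ,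
    recursive-case (clocked-recursive g) (recursive-const 0) (weaken rφ) ,
    flag′
    where
    flag′ : ∀ ys → Flagged (pred (clocked g ys) ∷ V ys) (evalVec (head ys) (g ∷ gs) (tail ys))
                           (caseℕ (clocked g ys) 0 (λ _ → φ ys))
    flag′ ys with eval (head ys) g (tail ys)
    ... | nothing = undefined
    ... | just y with evalVec (head ys) gs (tail ys) | φ ys | flag ys
    ...   | .nothing       | .0       | undefined = undefined
    ...   | .(just (V ys)) | .(suc _) | defined   = defined

-- Computable and c.e. sets as zero sets of total recursive functions

isZero-swap : ∀ {y} → isZero y ≡ 0 ⇔ y ≢ 0
isZero-swap {zero}  = mk⇔ (λ ()) (λ 0≢0 → contradiction refl 0≢0)
isZero-swap {suc y} = mk⇔ (λ _ ()) (λ _ → refl)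

either : ℕ → ℕ → ℕ
either a b = caseℕ a 0 (λ _ → b)

either≡0 : ∀ {a b} → either a b ≡ 0 ⇔ (a ≡ 0 ⊎ b ≡ 0)
either≡0 {zero}  = mk⇔ (λ _ → inj₁ refl) (λ _ → refl)
either≡0 {suc a} = mk⇔ inj₂ λ { (inj₁ ()) ; (inj₂ e) → e }

recursive-either : Recursive F → Recursive G → Recursive (λ xs → either (F xs) (G xs))
recursive-either rF rG = recursive-case rF (recursive-const 0) (weaken rG)

dom : Code 1 → SetN
dom c x = ∃[ y ] (c ⟨ x ∷ [] ⟩↓ y)

-- In contrast to `Computable`, a value is supplied at every argument without first deciding
-- membership, so deciders compose constructively.
Decider : SetN → Set
Decider X = ∃[ χ ] (TotalComputableFn χ × (∀ x → X x ⇔ χ x ≡ 0))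

-- An increasing, uniformly recursive approximation to `X`. Monotonicity allows a stage to be
-- enlarged to meet a further requirement.
Stages : SetN → Set
Stages X = ∃[ P ] (Recursive P × (∀ x → X x ⇔ (∃[ n ] (P (n ∷ x ∷ []) ≡ 0))) ×
  (∀ {m n x} → m ≤ n → P (m ∷ x ∷ []) ≡ 0 → P (n ∷ x ∷ []) ≡ 0))

private variable
  X Y : SetN
  f   : ℕ → ℕ

decider⇒computable : Decider X → Computable X
decider⇒computable {X = X} (χ , tχ , X⇔) with c , p ← recursive-isZero (apply tχ (var {n = 1} zero)) =
  c , λ x → (λ Xx  → subst (c ⟨ x ∷ [] ⟩↓_) (cong isZero (to (X⇔ x) Xx)) (p (x ∷ []))) ,
            (λ ¬Xx → subst (c ⟨ x ∷ [] ⟩↓_) (from isZero-swap (¬Xx ∘ from (X⇔ x))) (p (x ∷ [])))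

decider-preimage : Decider X → TotalComputableFn f → Decider (X ∘ f)
decider-preimage {f = f} (χ , tχ , X⇔) tf =
  χ ∘ f , toTotal (apply tχ (apply tf (var zero))) , λ x → X⇔ (f x)

fixed-points-decider : TotalComputableFn f → Decider (λ x → f x ≡ x)
fixed-points-decider {f} tf =
  (λ x → distance (f x) x) , toTotal (recursive-distance (apply tf (var zero)) (var zero)) ,
  λ x → mk⇔ distance-refl distance≡0

ce⇒stages : CE X → Stages X
ce⇒stages {X} (c , X⇔) = isZero ∘ clocked c , recursive-isZero (clocked-recursive c) , (λ x → mk⇔ complete sound) , mono
  where
  complete : ∀ {x} → X x → ∃[ n ] (isZero (clocked c (n ∷ x ∷ [])) ≡ 0)
  complete {x} Xx with y , k , e ← to (X⇔ x) Xx = k , cong (isZero ∘ encode) e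
  sound : ∀ {x} → ∃[ n ] (isZero (clocked c (n ∷ x ∷ [])) ≡ 0) → X x
  sound {x} (n , e) with eval n c (x ∷ []) in eq
  ... | just y = from (X⇔ x) (y , n , eq)
  mono : ∀ {m n x} → m ≤ n → isZero (clocked c (m ∷ x ∷ [])) ≡ 0 → isZero (clocked c (n ∷ x ∷ [])) ≡ 0
  mono {m} {x = x} m≤n e with eval m c (x ∷ []) in eq
  ... | just y = cong (isZero ∘ encode) (eval-mono m≤n c (x ∷ []) eq)

zeros⇒ce : {P : Vec ℕ 2 → ℕ} → Recursive P → (∀ x → X x ⇔ (∃[ n ] (P (n ∷ x ∷ []) ≡ 0))) → CE X
zeros⇒ce {X} {P} (c , p) X⇔ = mu c , λ x → mk⇔ converges halted
  where
  converges : ∀ {x} → X x → ∃[ y ] (mu c ⟨ x ∷ [] ⟩↓ y)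
  converges {x} Xx with n , e ← to (X⇔ x) Xx
    with y , e′ , below ← least (λ n → P (n ∷ x ∷ [])) {n} e =
    y , mu-least c (λ n → P (n ∷ x ∷ [])) (λ n → p (n ∷ x ∷ [])) e′ below
  halted : ∀ {x} → ∃[ y ] (mu c ⟨ x ∷ [] ⟩↓ y) → X x
  halted {x} (y , suc k , e) = from (X⇔ x) (y , ↓-functional c (p (y ∷ x ∷ [])) (search-zero k c 0 e))

decider⇒ce : Decider X → CE X
decider⇒ce (χ , tχ , X⇔) =
  zeros⇒ce (apply tχ (var (suc zero))) λ x → mk⇔ (λ Xx → 0 , to (X⇔ x) Xx) (from (X⇔ x) ∘ proj₂)

ce-∪-decider : CE X → Decider Y → CE (λ x → X x ⊎ Y x)
ce-∪-decider ceX (χ , tχ , Y⇔) with P , rP , X⇔ , _ ← ce⇒stages ceX =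
  zeros⇒ce (recursive-either (rP ∘ᵛ vars) (apply tχ (var (suc zero)))) λ x → mk⇔
    (λ { (inj₁ Xx) → proj₁ (to (X⇔ x) Xx) , from either≡0 (inj₁ (proj₂ (to (X⇔ x) Xx)))
       ; (inj₂ Yx) → 0 , from (either≡0 {P (0 ∷ x ∷ [])}) (inj₂ (to (Y⇔ x) Yx)) })
    (λ (n , e) → Sum.map (λ z → from (X⇔ x) (n , z)) (from (Y⇔ x)) (to either≡0 e))

ce-preimage : CE X → TotalComputableFn f → (∀ x → Y x ⇔ X (f x)) → CE Y
ce-preimage {f = f} ceX tf Y⇔ with P , rP , X⇔ , _ ← ce⇒stages ceX =
  zeros⇒ce (rP ∘ᵛ (var zero ∷ᵛ apply tf (var (suc zero)) ∷ᵛ []ᵛ)) λ x → mk⇔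
    (λ Yx → to (X⇔ (f x)) (to (Y⇔ x) Yx))
    (λ z → from (Y⇔ x) (from (X⇔ (f x)) z))

-- Post's theorem. Some stage shows `x` in one of the two sets; at the least such stage,
-- disjointness makes the test for `X` decisive.
complementary-ce⇒computable : CE X → CE Y → (∀ x → X x ⊎ Y x) → Disjoint X Y → Computable X
complementary-ce⇒computable {X} {Y} ceX ceY cover disjoint
  with P , rP , X⇔ , _ ← ce⇒stages ceX | Q , rQ , Y⇔ , _ ← ce⇒stages ceY
  with M , rM , hit , _ ← minimise (recursive-either rP rQ) (λ { (x ∷ []) →
         [ (λ Xx → proj₁ (to (X⇔ x) Xx) , from either≡0 (inj₁ (proj₂ (to (X⇔ x) Xx))))
         , (λ Yx → proj₁ (to (Y⇔ x) Yx) , from (either≡0 {P (_ ∷ x ∷ [])}) (inj₂ (proj₂ (to (Y⇔ x) Yx)))) ]′ (cover x) })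
  = decider⇒computable ((λ x → P (M (x ∷ []) ∷ x ∷ [])) , toTotal (rP ∘ᵛ (rM ∷ᵛ vars)) ,
      λ x → mk⇔ (accepts x) (λ e → from (X⇔ x) (M (x ∷ []) , e)))
  where
  accepts : ∀ x → X x → P (M (x ∷ []) ∷ x ∷ []) ≡ 0
  accepts x Xx with to either≡0 (hit (x ∷ []))
  ... | inj₁ e = e
  ... | inj₂ e = ⊥-elim (disjoint x Xx (from (Y⇔ x) (M (x ∷ []) , e)))

-- Effective selection of values and fibre representatives

-- Dovetail the enumeration of `X` until some `d` with `x ≤ f d` appears. The bound `x ≤ v x` later
-- gives finite fibres, since `v x ≡ y` forces `x ≤ y`.
unbounded-selection : CE X → TotalComputableFn f → (∀ b → ∃[ d ] (X d × b ≤ f d)) →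
  ∃[ v ] (TotalComputableFn v × (∀ x → ∃[ d ] (X d × v x ≡ f d)) × (∀ x → x ≤ v x))
unbounded-selection {X} {f} ceX tf unbounded
  with P , rP , X⇔ , mono ← ce⇒stages ceX = select
  where
  bad : ℕ → ℕ → ℕ → ℕ
  -- The sum is a conjunction of zero tests: `d` has been enumerated by stage `n`, and `x ≤ f d`.
  bad d n x = P (n ∷ d ∷ []) + (x ∸ f d)
  -- A value suc d reports that d < j is good at stage n, and 0 that there is none.
  find : ℕ → ℕ → ℕ → ℕ
  find j n x = recℕ j 0 (λ d r → caseℕ (bad d n x) (suc d) (λ _ → r))
  recursive-find : Recursive {3} (λ xs → find (lookup xs zero) (lookup xs (suc zero)) (lookup xs (suc (suc zero))))
  recursive-find = recursive-rec (var zero) (recursive-const 0)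
    (recursive-case
      (recursive-+ (rP ∘ᵛ (var (suc (suc (suc zero))) ∷ᵛ var zero ∷ᵛ []ᵛ))
        (recursive-∸ (var (suc (suc (suc (suc zero))))) (apply tf (var zero))))
      (recursive-suc (var zero)) (var (suc (suc zero))))
  sound : ∀ j {n x} → find j n x ≢ 0 → bad (pred (find j n x)) n x ≡ 0
  sound zero    ≢0 = contradiction refl ≢0
  sound (suc j) {n} {x} ≢0 with bad j n x in eq
  ... | zero  = eq
  ... | suc _ = sound j ≢0
  complete : ∀ {j d n x} → d < j → bad d n x ≡ 0 → find j n x ≢ 0
  complete {suc j} {d} {n} {x} d<j e with bad j n x in eq
  ... | zero = λ ()
  ... | suc _ with m<1+n⇒m<n∨m≡n d<j
  ...   | inj₁ d<j′ = complete d<j′ e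
  ...   | inj₂ refl = contradiction (trans (sym eq) e) λ ()
  exists : ∀ x → ∃[ n ] (isZero (find n n x) ≡ 0)
  exists x with d , Xd , x≤fd ← unbounded x with n , e ← to (X⇔ d) Xd =
    -- One number serves both as a search bound above `d` and as a stage by which `d` has appeared,
    -- so a single minimisation suffices.
    suc d ⊔ n , from isZero-swap (complete (m≤m⊔n (suc d) n) good)
    where
    good : bad d (suc d ⊔ n) x ≡ 0
    good rewrite mono {x = d} (m≤n⊔m (suc d) n) e = m≤n⇒m∸n≡0 x≤fd
  search-stage : ∃[ M ] (Recursive M × (∀ xs → isZero (find (M xs) (M xs) (lookup xs zero)) ≡ 0))
  search-stage =
    let M , rM , hit , _ = minimise {F = λ ys → isZero (find (lookup ys zero) (lookup ys zero) (lookup ys (suc zero)))}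
          (recursive-isZero (recursive-find ∘ᵛ (var zero ∷ᵛ var zero ∷ᵛ var (suc zero) ∷ᵛ []ᵛ)))
          (λ { (x ∷ []) → exists x })
    in M , rM , hit
  select : ∃[ v ] (TotalComputableFn v × (∀ x → ∃[ d ] (X d × v x ≡ f d)) × (∀ x → x ≤ v x))
  select =
    f ∘ u ,
    toTotal (apply tf (recursive-pred (recursive-find ∘ᵛ (rM ∷ᵛ rM ∷ᵛ var zero ∷ᵛ []ᵛ)))) ,
    (λ x → u x , from (X⇔ (u x)) (M (x ∷ []) , m+n≡0⇒m≡0 (P (M (x ∷ []) ∷ u x ∷ [])) (good x)) , refl) ,
    (λ x → m∸n≡0⇒m≤n (m+n≡0⇒n≡0 (P (M (x ∷ []) ∷ u x ∷ [])) (good x)))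
    where
    M : Vec ℕ 1 → ℕ
    M = proj₁ search-stage
    rM : Recursive M
    rM = proj₁ (proj₂ search-stage)
    u : ℕ → ℕ
    u x = pred (find (M (x ∷ [])) (M (x ∷ [])) x)
    good : ∀ x → bad (u x) (M (x ∷ [])) x ≡ 0
    good x = sound (M (x ∷ [])) (to isZero-swap (proj₂ (proj₂ search-stage) (x ∷ [])))

-- The search through the fibre of `x` halts because `x` lies in it. Arguments with equal values
-- search the same fibre, so each representative is at most the other.
least-representative : TotalComputableFn f →
  ∃[ s ] (TotalComputableFn s × (∀ x → f (s x) ≡ f x) × (∀ {x y} → f x ≡ f y → s x ≡ s y))
least-representative {f} tf =
  s , toTotal (proj₁ (proj₂ search-fibre)) , same ,
  λ {x} {y} e → ≤-antisym (least-in-fibre (trans (same y) (sym e))) (least-in-fibre (trans (same x) e))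
  where
  gap : Vec ℕ 2 → ℕ
  gap ys = distance (f (lookup ys zero)) (f (lookup ys (suc zero)))
  recursive-gap : Recursive gap
  recursive-gap = recursive-distance (apply tf (var zero)) (apply tf (var (suc zero)))
  search-fibre : ∃[ M ] (Recursive M × (∀ xs → gap (M xs ∷ xs) ≡ 0) × (∀ xs y → gap (y ∷ xs) ≡ 0 → M xs ≤ y))
  search-fibre = minimise recursive-gap λ { (x ∷ []) → x , distance-refl {f x} refl }
  s : ℕ → ℕ
  s x = proj₁ search-fibre (x ∷ [])
  same : ∀ x → f (s x) ≡ f x
  same x = distance≡0 (proj₁ (proj₂ (proj₂ search-fibre)) (x ∷ []))
  least-in-fibre : ∀ {x z} → f z ≡ f x → s x ≤ z
  least-in-fibre {x} {z} e = proj₂ (proj₂ (proj₂ search-fibre)) (x ∷ []) z (distance-refl e)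

-- Classical facts on finite and infinite sets

module Classical (em : ExcludedMiddle 0ℓ) where

  -- No computability is claimed: this makes `least` applicable to arbitrary sets and supplies the
  -- constants of finite tables.
  indicator : (X : SetN) → ∃[ h ] (∀ x → X x ⇔ h x ≡ 0)
  indicator X = (λ x → proj₁ (value x)) , (λ x → proj₂ (value x))
    where
    value : ∀ x → ∃[ v ] (X x ⇔ v ≡ 0)
    value x with em {X x}
    ... | yes Xx = 0 , mk⇔ (λ _ → refl) (λ _ → Xx)
    ... | no ¬Xx = 1 , mk⇔ (λ Xx → contradiction Xx ¬Xx) λ ()

  computable⇒decider : Computable X → Decider X
  computable⇒decider {X} (c , p) = (λ x → isZero (proj₁ (value x))) ,
    toTotal (recursive-isZero (apply (c , λ x → proj₁ (proj₂ (value x))) (var zero))) ,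
    (λ x → proj₂ (proj₂ (value x)))
    where
    value : ∀ x → ∃[ v ] (c ⟨ x ∷ [] ⟩↓ v × (X x ⇔ isZero v ≡ 0))
    value x with em {X x}
    ... | yes Xx = 1 , proj₁ (p x) Xx , mk⇔ (λ _ → refl) (λ _ → Xx)
    ... | no ¬Xx = 0 , proj₂ (p x) ¬Xx , mk⇔ (λ Xx → contradiction Xx ¬Xx) λ ()

  -- The finite table of memberships is hard-wired into the program, one entry per step of the
  -- induction on `b`.
  bounded⇒decider : ∀ b → (∀ x → X x → x < b) → Decider X
  bounded⇒decider zero    bound =
    (λ _ → 1) , toTotal (recursive-const 1) , λ x → mk⇔ (λ Xx → contradiction (bound x Xx) λ ()) λ ()
  bounded⇒decider {X} (suc b) bound
    with h , X⇔h ← indicator X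
       | χ , tχ , X⇔χ ← bounded⇒decider {X ∘ suc} b (λ x Xx → s≤s⁻¹ (bound (suc x) Xx)) =
    (λ x → caseℕ x (h 0) χ) ,
    toTotal (recursive-case (var zero) (recursive-const (h 0)) (apply tχ (var zero))) ,
    λ { zero → X⇔h 0 ; (suc x) → X⇔χ x }

  bounded-or-unbounded : (X : SetN) (f : ℕ → ℕ) →
    (∃[ b ] (∀ x → X x → f x < b)) ⊎ (∀ b → ∃[ x ] (X x × b ≤ f x))
  bounded-or-unbounded X f with em {∃[ b ] (∀ x → X x → f x < b)}
  ... | yes bounded   = inj₁ bounded
  ... | no ¬bounded = inj₂ λ b → em⇒dne em λ none →
    ¬bounded (b , λ x Xx → ≰⇒> λ b≤fx → none (x , Xx , b≤fx))

  infinite⇒unbounded : Infinite X → ∀ b → ∃[ x ] (X x × b ≤ x)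
  infinite⇒unbounded {X} inf with bounded-or-unbounded X id
  ... | inj₁ bounded   = contradiction bounded inf
  ... | inj₂ unbounded = unbounded

  -- The increasing enumeration, used only to index a family, so it need not be computable. The
  -- inequality `i ≤ e i` turns a bound on values into a bound on indices.
  enumeration : Infinite X → 
    ∃[ e ] ((∀ i → X (e i)) × (∀ i → i ≤ e i) × (∀ {i j} → e i ≡ e j → i ≡ j) × (∀ x → X x → ∃[ i ] x ≡ e i))
  enumeration {X} inf = e , member , i≤e , injective , λ x Xx → surjective (suc x) Xx (i≤e (suc x))
    where
    next : ∀ b → ∃[ x ] ((X x × b ≤ x) × (∀ z → X z × b ≤ z → x ≤ z))
    next b with h , h⇔ ← indicator (λ x → X x × b ≤ x) | x , X≥b ← infinite⇒unbounded inf b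
      with y , e , below ← least h {x} (to (h⇔ x) X≥b) =
      y , from (h⇔ y) e , λ z p → below z (to (h⇔ z) p)
    e : ℕ → ℕ
    e zero    = proj₁ (next 0)
    e (suc i) = proj₁ (next (suc (e i)))
    member : ∀ i → X (e i)
    member zero    = proj₁ (proj₁ (proj₂ (next 0)))
    member (suc i) = proj₁ (proj₁ (proj₂ (next (suc (e i)))))
    increasing : ∀ i → e i < e (suc i)
    increasing i = proj₂ (proj₁ (proj₂ (next (suc (e i)))))
    e-mono : ∀ {i j} → i < j → e i < e j
    e-mono {i} {suc j} i<1+j with m<1+n⇒m<n∨m≡n i<1+j
    ... | inj₁ i<j  = <-trans (e-mono i<j) (increasing j)
    ... | inj₂ refl = increasing j
    injective : ∀ {i j} → e i ≡ e j → i ≡ j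
    injective {i} {j} ei≡ej with <-cmp i j
    ... | tri< i<j _ _ = contradiction ei≡ej (<⇒≢ (e-mono i<j))
    ... | tri≈ _ i≡j _ = i≡j
    ... | tri> _ _ j<i = contradiction (sym ei≡ej) (<⇒≢ (e-mono j<i))
    i≤e : ∀ i → i ≤ e i
    i≤e zero    = z≤n
    i≤e (suc i) = ≤-trans (s≤s (i≤e i)) (increasing i)
    surjective : ∀ i {x} → X x → x < e i → ∃[ j ] x ≡ e j
    surjective zero    {x} Xx x<e = contradiction (proj₂ (proj₂ (next 0)) x (Xx , z≤n)) (<⇒≱ x<e)
    surjective (suc i) {x} Xx x<e with <-cmp x (e i)
    ... | tri< x<ei _ _ = surjective i Xx x<ei
    ... | tri≈ _ x≡ei _ = i , x≡ei
    ... | tri> _ _ x>ei = contradiction (proj₂ (proj₂ (next (suc (e i)))) x (Xx , x>ei)) (<⇒≱ x<e)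

  -- A union of finitely many finite fibres is finite; the induction on `b` adds the fibre of each
  -- new value only when it is finite.
  bounded-small-fibres : (f : ℕ → ℕ) → ∀ b → Finite (λ x → f x < b × Finite (λ z → f z ≡ f x))
  bounded-small-fibres f zero = 0 , λ { x (() , _) }
  bounded-small-fibres f (suc b) with p , below ← bounded-small-fibres f b | em {Finite (λ z → f z ≡ b)}
  ... | yes (q , fibre<q) = p ⊔ q , bound
    where
    bound : ∀ x → f x < suc b × Finite (λ z → f z ≡ f x) → x < p ⊔ q
    bound x (fx<1+b , fin) with m<1+n⇒m<n∨m≡n fx<1+b
    ... | inj₁ fx<b = <-≤-trans (below x (fx<b , fin)) (m≤m⊔n p q)
    ... | inj₂ fx≡b = <-≤-trans (fibre<q x fx≡b) (m≤n⊔m p q)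
  ... | no infinite = p , bound
    where
    bound : ∀ x → f x < suc b × Finite (λ z → f z ≡ f x) → x < p
    bound x (fx<1+b , fin) with m<1+n⇒m<n∨m≡n fx<1+b
    ... | inj₁ fx<b = below x (fx<b , fin)
    ... | inj₂ refl = contradiction fin infinite

  -- From a many-one reduction to a finite-one reduction

  module Reduction {A B : SetN} {f : ℕ → ℕ} (tf : TotalComputableFn f) (A⇔ : ∀ x → A x ⇔ B (f x)) where

    fibre : ℕ → SetN
    fibre y x = f x ≡ y

    InfiniteFibreOutside : SetN
    InfiniteFibreOutside y = ¬ B y × Infinite (fibre y)

    bounded-preimage⇒decider : ∀ b → (∀ y → Y y → y < b) → Decider (Y ∘ f)
    bounded-preimage⇒decider b bound = decider-preimage (bounded⇒decider b bound) tf

    -- A c.e. set disjoint from `A` then meets only finitely many fibres, and the finite ones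
    -- contribute finitely many points, so it is almost contained in `U`. The type depends on
    -- whether infinitely many values have infinite fibres outside `B`, and if not, on whether `U`
    -- is infinite.
    bounded⇒generatingFamily :
      (∀ D → CE D → Disjoint D A → ∃[ b ] (∀ x → D x → f x < b)) →
      HasGenType 1 A ⊎ HasGenType 2 A ⊎ HasGenType 4 A
    bounded⇒generatingFamily bounded = cases
      where
      U : SetN
      U = InfiniteFibreOutside ∘ f

      almost⊆U : ∀ D → CE D → Disjoint D A →
        ∃[ b ] ((∀ x → D x → f x < b) × D ⊆* U)
      almost⊆U D ceD disjoint with b , f<b ← bounded D ceD disjoint with n , below ← bounded-small-fibres f b =
        b , f<b , n , λ x (Dx , ¬Ux) → below x (f<b x Dx , em⇒dne em λ inf →
          ¬Ux ((λ Bfx → disjoint x Dx (from (A⇔ x) Bfx)) , inf))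

      U∩A=∅ : Disjoint U A
      U∩A=∅ x (¬Bfx , _) Ax = ¬Bfx (to (A⇔ x) Ax)

      type4 : Infinite InfiniteFibreOutside → HasGenType 4 A
      type4 inf with e , member , i≤e , injective , surjective ← enumeration inf =
        (λ i → fibre (e i)) ,
        (λ i → proj₂ (member i) , decider⇒computable (fibre-decider i)) ,
        (λ i j i≢j x fx≡ei fx≡ej → i≢j (injective (trans (sym fx≡ei) fx≡ej))) ,
        (λ i → decider⇒ce (fibre-decider i)) ,
        (λ i x fx≡ei Ax → proj₁ (member i) (subst B fx≡ei (to (A⇔ x) Ax))) ,
        generates
        where
        fibre-decider : ∀ i → Decider (fibre (e i))
        fibre-decider i = bounded-preimage⇒decider {λ y → y ≡ e i} (suc (e i)) (λ { y refl → ≤-refl })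
        generates : ∀ D → CE D → Disjoint D A → ∃[ F ] (D ⊆* UnionOver (λ i → fibre (e i)) F)
        generates D ceD disjoint with b , f<b , n , below ← almost⊆U D ceD disjoint =
          -- A point of `D` in `U` has value `e i` with `i ≤ e i < b`, so indices below `b` suffice.
          upTo b , n , λ x (Dx , ¬∪) → below x (Dx , λ Ux →
            let i , fx≡ei = surjective (f x) Ux
            in ¬∪ (i , ∈-upTo⁺ (≤-<-trans (subst (i ≤_) (sym fx≡ei) (i≤e i)) (f<b x Dx)) , fx≡ei))

      type2 : Decider U → Infinite U → HasGenType 2 A
      type2 dU inf = U , inf , decider⇒computable dU , (λ _ → decider⇒ce dU) , (λ _ → U∩A=∅) ,
        λ D ceD disjoint → let _ , _ , n , below = almost⊆U D ceD disjoint in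
          [ tt ] , n , λ x (Dx , ¬∪) → below x (Dx , λ Ux → ¬∪ (tt , here refl , Ux))

      type1 : Finite U → HasGenType 1 A
      type1 (m , U<m) = (λ _ → decider⇒ce (bounded⇒decider 0 λ _ ())) , (λ _ _ ()) , generates
        where
        generates : ∀ D → CE D → Disjoint D A → ∃[ F ] (D ⊆* UnionOver (λ _ → Empty) F)
        generates D ceD disjoint with _ , _ , n , below ← almost⊆U D ceD disjoint = [ tt ] , m ⊔ n , bound
          where
          bound : ∀ x → (D ∖ UnionOver (λ _ → Empty) [ tt ]) x → x < m ⊔ n
          bound x (Dx , _) with em {U x}
          ... | yes Ux = <-≤-trans (U<m x Ux) (m≤m⊔n m n)
          ... | no ¬Ux = <-≤-trans (below x (Dx , ¬Ux)) (m≤n⊔m m n)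

      cases : HasGenType 1 A ⊎ HasGenType 2 A ⊎ HasGenType 4 A
      cases with em {Finite InfiniteFibreOutside} | em {Finite U}
      ... | no inf            | _        = inj₂ (inj₂ (type4 inf))
      ... | yes _             | yes fin  = inj₁ (type1 fin)
      -- Here `U` is the preimage under `f` of a bounded set of values, hence decidable.
      ... | yes (b , bound)   | no inf   = inj₂ (inj₁ (type2 (bounded-preimage⇒decider b bound) inf))

    unboundedOutside :
      ¬ HasGenType 1 A → ¬ HasGenType 2 A → ¬ HasGenType 4 A →
      ∃[ v ] (TotalComputableFn v × (∀ x → ¬ B (v x)) × (∀ x → x ≤ v x))
    unboundedOutside ¬1 ¬2 ¬4
      -- Quantifying over codes instead of sets keeps this proposition in `Set`, where `em` applies.
      with em {∃[ c ] (Disjoint (dom c) A × (∀ b → ∃[ x ] (dom c x × b ≤ f x)))}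
    ... | yes (c , disjoint , unbounded) =
      let v , tv , image , x≤v = unbounded-selection {dom c} (c , λ x → mk⇔ id id) tf unbounded in
      v , tv , (λ x Bvx → let d , dom-d , vx≡fd = image x in
        disjoint d dom-d (from (A⇔ d) (subst B vx≡fd Bvx))) , x≤v
    ... | no none = ⊥-elim ([ ¬1 , [ ¬2 , ¬4 ]′ ]′ (bounded⇒generatingFamily bounded))
      where
      bounded : ∀ D → CE D → Disjoint D A → ∃[ b ] (∀ x → D x → f x < b)
      bounded D (c , D⇔) disjoint with bounded-or-unbounded D f
      ... | inj₁ b         = b
      ... | inj₂ unbounded = ⊥-elim (none
        (c , (λ x dom-x → disjoint x (from (D⇔ x) dom-x)) ,
          λ b → let x , Dx , b≤fx = unbounded b in x , to (D⇔ x) Dx , b≤fx))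

    -- If `f` were bounded on `A`, then `A` would be the preimage of a bounded part of `B`, and so
    -- computable.
    unboundedInside : CE A → ¬ Computable A →
      ∃[ v ] (TotalComputableFn v × (∀ x → B (v x)) × (∀ x → x ≤ v x))
    unboundedInside ceA ¬comp with bounded-or-unbounded A f
    ... | inj₁ (b , f<b) = ⊥-elim (¬comp (decider⇒computable (proj₁ decider , proj₁ (proj₂ decider) , λ x → mk⇔
        (λ Ax → to (proj₂ (proj₂ decider) x) (to (A⇔ x) Ax , f<b x Ax))
        (λ e → from (A⇔ x) (proj₁ (from (proj₂ (proj₂ decider) x) e))))))
      where
      decider : Decider (λ x → B (f x) × f x < b)
      decider = bounded-preimage⇒decider {λ y → B y × y < b} b (λ _ → proj₂)
    ... | inj₂ unbounded =
      let v , tv , image , x≤v = unbounded-selection {A} ceA tf unbounded in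
      v , tv , (λ x → let d , Ad , vx≡fd = image x in subst B (sym vx≡fd) (to (A⇔ d) Ad)) , x≤v

    dmaximal-splitting : DMaximal A → {s : ℕ → ℕ} → TotalComputableFn s → (∀ x → f (s x) ≡ f x) →
      (∀ {x y} → f x ≡ f y → s x ≡ s y) →
      ∃[ R ] (Computable R × A ⊆ R × (∀ x → R x → A x ⊎ s x ≡ x))
    dmaximal-splitting (ceA , ¬compA , dichotomy) {s} ts same cong-s =
      [ (λ ceRest → ⊥-elim (¬compA (computable ceRest))) , id ]′ (dichotomy W ceW (λ _ → inj₁))
      where
      W : SetN
      W x = A x ⊎ s x ≡ x
      ceW : CE W
      ceW = ce-∪-decider {A} {λ x → s x ≡ x} ceA (fixed-points-decider ts)
      A⇔A∘s : ∀ x → A x ⇔ A (s x)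
      A⇔A∘s x = mk⇔ (λ Ax → from (A⇔ (s x)) (subst B (sym (same x)) (to (A⇔ x) Ax)))
                    (λ Asx → from (A⇔ x) (subst B (same x) (to (A⇔ (s x)) Asx)))
      complement : ∀ x → (¬ A x) ⇔ (W ∖ A) (s x)
      -- Since `f (s x)` equals `f x`, `s x` is a fixed point of `s` and so belongs to `W` for every
      -- `x`.
      complement x = mk⇔ (λ ¬Ax → inj₂ (cong-s (same x)) , ¬Ax ∘ from (A⇔A∘s x))
                         (λ (_ , ¬Asx) → ¬Asx ∘ to (A⇔A∘s x))
      excluded : ∀ x → A x ⊎ ¬ A x
      excluded x with em {A x}
      ... | yes Ax = inj₁ Ax
      ... | no ¬Ax = inj₂ ¬Ax
      computable : CE (W ∖ A) → Computable A
      computable ceRest = complementary-ce⇒computable {A} {λ x → ¬ A x} ceA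
        (ce-preimage {W ∖ A} ceRest ts complement) excluded λ x Ax ¬Ax → ¬Ax Ax

    -- A value `y` comes from `f` at no more than one fixed point of `s`, namely `s z` for any `z`
    -- in the fibre over `y`. On the other two branches `x ≤ g x`, so `x ≤ y`.
    splice : {R : SetN} {s u v : ℕ → ℕ} → Decider R → A ⊆ R →
      TotalComputableFn s → (∀ {x y} → f x ≡ f y → s x ≡ s y) → (∀ x → R x → A x ⊎ s x ≡ x) →
      TotalComputableFn u → (∀ x → B (u x)) → (∀ x → x ≤ u x) →
      TotalComputableFn v → (∀ x → ¬ B (v x)) → (∀ x → x ≤ v x) →
      A ≤fo B
    splice {R} {s} {u} {v} (ρ , tρ , R⇔) A⊆R ts cong-s R⊆ tu Bu x≤u tv ¬Bv x≤v =
      g , recursive-g , finite , A⇔g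
      where
      g : ℕ → ℕ
      g x = caseℕ (ρ x) (caseℕ (distance (s x) x) (f x) (λ _ → u x)) (λ _ → v x)
      recursive-g : TotalComputableFn g
      recursive-g = toTotal (recursive-case (apply tρ (var zero))
        (recursive-case (recursive-distance (apply ts (var zero)) (var zero))
          (apply tf (var zero)) (apply tu (var (suc zero))))
        (apply tv (var (suc zero))))
      finite : FiniteFibres g
      finite y with em {∃[ z ] f z ≡ y}
      ... | yes (z , fz≡y) = suc (s z ⊔ y) , bound
        where
        bound : ∀ x → g x ≡ y → x < suc (s z ⊔ y)
        bound x gx≡y with ρ x
        ... | suc _ = s≤s (≤-trans (x≤v x) (≤-trans (≤-reflexive gx≡y) (m≤n⊔m (s z) y)))
        ... | zero with distance (s x) x in eq
        ...   | suc _ = s≤s (≤-trans (x≤u x) (≤-trans (≤-reflexive gx≡y) (m≤n⊔m (s z) y)))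
        ...   | zero  = s≤s (≤-trans
          (≤-reflexive (trans (sym (distance≡0 eq)) (cong-s (trans gx≡y (sym fz≡y))))) (m≤m⊔n (s z) y))
      ... | no empty = suc y , bound
        where
        bound : ∀ x → g x ≡ y → x < suc y
        bound x gx≡y with ρ x
        ... | suc _ = s≤s (≤-trans (x≤v x) (≤-reflexive gx≡y))
        ... | zero with distance (s x) x
        ...   | suc _ = s≤s (≤-trans (x≤u x) (≤-reflexive gx≡y))
        ...   | zero  = contradiction (x , gx≡y) empty
      A⇔g : ∀ x → A x ⇔ B (g x)
      A⇔g x with ρ x in eq
      ... | suc _ = mk⇔ (λ Ax → contradiction (trans (sym eq) (to (R⇔ x) (A⊆R x Ax))) λ ())
                        (λ Bvx → contradiction Bvx (¬Bv x))
      ... | zero with distance (s x) x in eq′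
      ...   | zero  = A⇔ x
      -- A point of `R` that `s` moves must lie in `A`, so sending it into `B` is correct.
      ...   | suc _ = mk⇔ (λ _ → Bu x) λ _ →
        [ id , (λ fixed → contradiction (trans (sym eq′) (distance-refl fixed)) λ ()) ]′ (R⊆ x (from (R⇔ x) eq))

    finiteOne : DMaximal A → ¬ HasGenType 1 A → ¬ HasGenType 2 A → ¬ HasGenType 4 A → A ≤fo B
    finiteOne dmaxA@(ceA , ¬compA , _) ¬1 ¬2 ¬4 =
      let s , ts , same , cong-s = least-representative tf
          R , compR , A⊆R , R⊆ = dmaximal-splitting dmaxA ts same cong-s
          u , tu , Bu , x≤u = unboundedInside ceA ¬compA
          v , tv , ¬Bv , x≤v = unboundedOutside ¬1 ¬2 ¬4
      in splice (computable⇒decider compR) A⊆R ts cong-s R⊆ tu Bu x≤u tv ¬Bv x≤v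

theorem6p7 : ExcludedMiddle 0ℓ →
    (A : SetN) → CE A → ¬ Computable A → DMaximal A →
    (OfType 8 A ⊎ OfType 9 A) →
    (B : SetN) → B ≡m A → A ≤fo B
theorem6p7 em A _ _ dmaxA type B (_ , f , tf , A⇔) =
  -- The inequalities are 2, 3, 5 ≤ 8, which unfold 1, 2, 4 < 8; the minimality clause of either
  -- type then applies.
  finiteOne dmaxA (no-type 1 (m≤m+n 2 6)) (no-type 2 (m≤m+n 3 5)) (no-type 4 (m≤m+n 5 3))
  where
  open Classical em
  open Reduction {A} {B} tf A⇔
  no-type : ∀ m → m < 8 → ¬ HasGenType m A
  no-type m m<8 = [ (λ (_ , lower) → lower m m<8) , (λ (_ , lower) → lower m (m<n⇒m<1+n m<8)) ]′ type
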